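{- For integers $n\ge2$ and $0\le t\le n-2$, the number of $(102,120)$-avoiding inversion sequences $e$ of length $n$ with $\mathrm{rank}(e)=t$ is $$\binom{2n-t-2}{n-t-1}-\binom{2n-2t-3}{n-t-1}.$$
   Context: An inversion sequence of length $n$ is an integer sequence $e=(e_1,\dots,e_n)$ with $0\le e_j\le j-1$ for all $j$. It contains a pattern $w=w_1w_2w_3$ if there are indices $i_1<i_2<i_3$ such that $e_{i_1}e_{i_2}e_{i_3}$ is order-isomorphic to $w$ (same relations $<,=,>$ between corresponding pairs of entries); otherwise it avoids $w$. "$(w,w')$-avoiding" means avoiding both $w$ and $w'$. $\max(e)$ is the largest entry, and $\mathrm{fdes}(e)$ is the position $p$ of the first descent: $e_1\le\cdots\le e_p>e_{p+1}$, with the convention $e_{n+1}=-1$. For a $102$-avoiding $e$, $\mathrm{rank}(e):=\mathrm{fdes}(e)-\max(e)-1$. -}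

module Defs where

open import Data.Bool.Base using (if_then_else_)
open import Data.Fin.Base as Fin using (Fin; toℕ)
open import Data.Integer.Base as ℤ using (ℤ; +_)
open import Data.List.Base using (List; length)
open import Data.List.Membership.Propositional using (_∈_)
open import Data.List.Relation.Unary.Unique.Propositional using (Unique)
open import Data.Nat.Base using (ℕ; suc; _≤_; _<_; _⊔_)
open import Data.Nat.Properties using (_<?_)
open import Data.Product.Base using (_×_; ∃-syntax)
open import Data.Vec.Base using (Vec; []; _∷_; lookup; foldr′)
open import Function.Bundles using (_⇔_)
open import Level as Level using (Level)
open import Relation.Binary.PropositionalEquality using (_≡_)
open import Relation.Nullary.Decidable.Core using (does)
open import Relation.Nullary.Negation using (¬_)
open import Relation.Unary using (Pred)

private
  variable
    a ℓ : Level
    k n : ℕ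

-- Positions are 0-based here, so the bound 0 ≤ e_j ≤ j - 1 for 1-based j
-- becomes lookup e j ≤ toℕ j.
IsInversionSequence : Vec ℕ n → Set
IsInversionSequence e = ∀ j → lookup e j ≤ toℕ j

-- The relation > is covered by exchanging i and j in the first component.
OrderIsomorphic : Vec ℕ k → Vec ℕ k → Set
OrderIsomorphic u w = ∀ i j →
  (lookup u i < lookup u j ⇔ lookup w i < lookup w j) ×
  (lookup u i ≡ lookup u j ⇔ lookup w i ≡ lookup w j)

Contains : Vec ℕ n → Vec ℕ 3 → Set
Contains e w = ∃[ i₁ ] ∃[ i₂ ] ∃[ i₃ ]
  i₁ Fin.< i₂ × i₂ Fin.< i₃ ×
  OrderIsomorphic (lookup e i₁ ∷ lookup e i₂ ∷ lookup e i₃ ∷ []) w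

Avoids : Vec ℕ n → Vec ℕ 3 → Set
Avoids e w = ¬ Contains e w

pattern102 pattern120 : Vec ℕ 3
pattern102 = 1 ∷ 0 ∷ 2 ∷ []
pattern120 = 1 ∷ 2 ∷ 0 ∷ []

-- Entries are natural numbers, so the base value 0 does not affect the
-- maximum of a nonempty sequence; the value on [] is a dummy.
max : Vec ℕ n → ℕ
max = foldr′ _⊔_ 0

-- The 1-based position of the first descent. The convention e_{n+1} = -1 makes
-- the last position a descent, hence the value 1 on a one-entry sequence.
-- The value on [] is a dummy.
fdes : Vec ℕ n → ℕ
fdes []           = 0
fdes (x ∷ [])     = 1
fdes (x ∷ y ∷ ys) = if does (y <? x) then 1 else suc (fdes (y ∷ ys))

rank : Vec ℕ n → ℤ
rank e = + fdes e ℤ.- + max e ℤ.- + 1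

-- "The number of x satisfying P is z": the elements satisfying P can be
-- listed without repetition, and the list has length z. Taking z in ℤ lets
-- counting formulas use genuine rather than truncated subtraction.
NumberOf_Is_ : {A : Set a} → Pred A ℓ → ℤ → Set (a Level.⊔ ℓ)
NumberOf_Is_ {A = A} P z = ∃[ xs ]
  Unique xs × (∀ (x : A) → x ∈ xs ⇔ P x) × + length xs ≡ z

{-# OPTIONS --safe #-}

-- A sequence avoids 102 and 120 exactly when, for every letter, the later
-- letters are all ≥ it or all ≤ it. So a sequence rises to its maximum and
-- then stays between the two largest values seen so far. Reading from the left,
-- the state while rising is the slack s = (0-based position) − (value),
-- and the rank is the slack at the first descent. This yields a recursion for
-- the count in s, solved at s = 0:
--  * deleting one of two equal entries just before the first descent lowers
--    both the rank and the length by one, which leaves the sequences that have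
--    a strict ascent to their first descent;
--  * for those, 2 ^ (q − 1) times the number of q-multisets counts the words of
--    length q after the descent, and a multiset continues the rising part, so
--    their number is a weighted sum of ballot numbers, which collapses to a
--    single binomial coefficient; summing over the rank is a hockey stick.
module Submission where

import Algebra.Properties.CommutativeSemigroup as CommutativeSemigroup
open import Data.Fin.Base as Fin using (zero; suc; toℕ)
import Data.Fin.Properties as Fin
open import Data.Integer.Base as ℤ using ()
import Data.Integer.Properties as ℤ
open import Data.Integer.Tactic.RingSolver using () renaming (solve-∀ to ℤ-solve-∀)
open import Data.List.Membership.Propositional using (_∈_)
open import Data.List.Base using ([]; _∷_; _++_; map)
open import Data.List.Membership.Propositional.Properties using (∈-map⁺; ∈-map⁻; ∈-++⁺ˡ; ∈-++⁺ʳ; ∈-++⁻)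
open import Data.List.Properties using (length-++; length-map)
import Data.List.Relation.Unary.All as ListAll
open import Data.List.Relation.Unary.AllPairs using ([]; _∷_)
open import Data.List.Relation.Unary.Any using (here; there)
import Data.List.Relation.Unary.Unique.Propositional.Properties as Unique
open import Data.Nat.Base
open import Data.Nat.Combinatorics using (_C_; nCk≡nC[n∸k]; nCk+nC[k+1]≡[n+1]C[k+1]; k>n⇒nCk≡0)
open import Data.Nat.Properties
open import Data.Nat.Tactic.RingSolver using (solve-∀)
open import Data.Product.Base using (_×_; _,_; proj₁; proj₂; ∃-syntax)
open import Data.Sum.Base as Sum using (_⊎_; inj₁; inj₂; [_,_]′)
open import Data.Unit.Base using (⊤; tt)
open import Data.Vec.Base as Vec using (Vec; []; _∷_; head; lookup; replicate)
open import Data.Vec.Properties using (∷-injectiveʳ; lookup-map)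
open import Data.Vec.Relation.Unary.All as All using (All; []; _∷_)
import Data.Vec.Relation.Unary.All.Properties as Allₚ
open import Data.Vec.Relation.Unary.Any as Any using ()
open import Data.Vec.Relation.Unary.Any.Properties using (lookup-index)
open import Function.Base using (_∘_)
open import Function.Bundles using (_⇔_; mk⇔; module Equivalence)
open import Level using (0ℓ)
open import Relation.Binary.Definitions using (tri<; tri≈; tri>)
open import Relation.Binary.PropositionalEquality
open import Relation.Nullary.Decidable using (yes; no; dec-true; dec-false)
open import Relation.Nullary.Negation using (¬_; contradiction)
open import Relation.Unary using (Pred)
open import Defs

open Equivalence using (to; from)
open CommutativeSemigroup +-commutativeSemigroup using (interchange; x∙yz≈y∙xz)
open ≡-Reasoning

-- Finite sums and binomial coefficients

∑ : ℕ → (ℕ → ℕ) → ℕ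
∑ zero    f = 0
∑ (suc n) f = ∑ n f + f n

∑-cong : ∀ n {f g : ℕ → ℕ} → (∀ i → i < n → f i ≡ g i) → ∑ n f ≡ ∑ n g
∑-cong zero    eq = refl
∑-cong (suc n) eq = cong₂ _+_ (∑-cong n (λ i i<n → eq i (m<n⇒m<1+n i<n))) (eq n ≤-refl)

∑-zero : ∀ n → ∑ n (λ _ → 0) ≡ 0
∑-zero zero    = refl
∑-zero (suc n) = trans (+-identityʳ _) (∑-zero n)

∑-+ : ∀ n (f g : ℕ → ℕ) → ∑ n (λ i → f i + g i) ≡ ∑ n f + ∑ n g
∑-+ zero    f g = refl
∑-+ (suc n) f g =
  trans (cong (_+ (f n + g n)) (∑-+ n f g)) (interchange (∑ n f) (∑ n g) (f n) (g n))

∑-* : ∀ n c (f : ℕ → ℕ) → ∑ n (λ i → c * f i) ≡ c * ∑ n f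
∑-* zero    c f = sym (*-zeroʳ c)
∑-* (suc n) c f =
  trans (cong (_+ c * f n) (∑-* n c f)) (sym (*-distribˡ-+ c (∑ n f) (f n)))

∑-head : ∀ n (f : ℕ → ℕ) → ∑ (suc n) f ≡ f 0 + ∑ n (λ i → f (suc i))
∑-head zero    f = +-comm 0 (f 0)
∑-head (suc n) f = trans (cong (_+ f (suc n)) (∑-head n f)) (+-assoc (f 0) _ _)

∑-reverse : ∀ n (f : ℕ → ℕ) → ∑ n (λ i → f (n ∸ i)) ≡ ∑ n (λ i → f (suc i))
∑-reverse zero    f = refl
∑-reverse (suc n) f = begin
  ∑ (suc n) (λ i → f (suc n ∸ i))   ≡⟨ ∑-head n (λ i → f (suc n ∸ i)) ⟩
  f (suc n) + ∑ n (λ i → f (n ∸ i)) ≡⟨ cong (f (suc n) +_) (∑-reverse n f) ⟩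
  f (suc n) + ∑ n (λ i → f (suc i)) ≡⟨ +-comm (f (suc n)) _ ⟩
  ∑ (suc n) (λ i → f (suc i))       ∎

∑-swap : ∀ m n (f : ℕ → ℕ → ℕ) → ∑ m (λ i → ∑ n (f i)) ≡ ∑ n (λ j → ∑ m (λ i → f i j))
∑-swap zero    n f = sym (∑-zero n)
∑-swap (suc m) n f =
  trans (cong (_+ ∑ n (f m)) (∑-swap m n f)) (sym (∑-+ n (λ j → ∑ m (λ i → f i j)) (f m)))

-- Stands for `g` at s - v, read as 0 when s < v, so that formulas in s - v can be stated for all s.
shift : ℕ → (ℕ → ℕ) → ℕ → ℕ
shift zero    g s       = g s
shift (suc v) g zero    = 0
shift (suc v) g (suc s) = shift v g s

shift-cong : ∀ v s {f g : ℕ → ℕ} → (∀ m → f m ≡ g m) → shift v f s ≡ shift v g s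
shift-cong zero    s       eq = eq s
shift-cong (suc v) zero    eq = refl
shift-cong (suc v) (suc s) eq = shift-cong v s eq

shift-+ : ∀ v m (g : ℕ → ℕ) → shift v g (v + m) ≡ g m
shift-+ zero    m g = refl
shift-+ (suc v) m g = shift-+ v m g

∑-shift : ∀ v s (g : ℕ → ℕ) → ∑ (suc s) (shift v g) ≡ shift v (λ m → ∑ (suc m) g) s
∑-shift zero    s       g = refl
∑-shift (suc v) zero    g = refl
∑-shift (suc v) (suc s) g = trans (∑-head (suc s) (shift (suc v) g)) (∑-shift v s g)

isZero : ℕ → ℕ
isZero zero    = 1
isZero (suc _) = 0

-- The Kronecker delta, encoded as a shifted point mass so that the lemmas on `shift` apply to it.
δ : ℕ → ℕ → ℕ
δ s t = shift t isZero s

pascal : ∀ n k → suc n C suc k ≡ n C k + n C suc k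
pascal n k = sym (nCk+nC[k+1]≡[n+1]C[k+1] n k)

-- For n ≥ t this is Pascal's rule in row n - t. At n + 1 = t the left side is `0 C suc k`, which is
-- 0 because the lower index is positive.
shift-pascal : ∀ t n k → shift t (_C suc k) (suc n) ≡ shift t (_C k) n + shift t (_C suc k) n
shift-pascal zero          n       k = pascal n k
shift-pascal (suc zero)    zero    k = refl
shift-pascal (suc (suc t)) zero    k = refl
shift-pascal (suc t)       (suc n) k = shift-pascal t n k

C-symm : ∀ m n → (m + n) C m ≡ (m + n) C n
C-symm m n = trans (nCk≡nC[n∸k] (m≤m+n m n)) (cong ((m + n) C_) (m+n∸m≡n m n))

hockey-stick : ∀ r m → ∑ (suc m) (λ i → (i + r) C r) ≡ (m + suc r) C suc r
hockey-stick r zero    = begin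
  r C r             ≡⟨ sym (+-identityʳ _) ⟩
  r C r + 0         ≡⟨ cong (r C r +_) (sym (k>n⇒nCk≡0 (n<1+n r))) ⟩
  r C r + r C suc r ≡⟨ sym (pascal r r) ⟩
  suc r C suc r     ∎
hockey-stick r (suc m) = begin
  ∑ (suc m) (λ i → (i + r) C r) + suc (m + r) C r ≡⟨ cong₂ _+_ (hockey-stick r m) (cong (_C r) (sym (+-suc m r))) ⟩
  (m + suc r) C suc r + (m + suc r) C r           ≡⟨ +-comm ((m + suc r) C suc r) _ ⟩
  (m + suc r) C r + (m + suc r) C suc r           ≡⟨ sym (pascal (m + suc r) r) ⟩
  suc (m + suc r) C suc r                         ∎

∑-row : ∀ s n → s < n → ∑ n (s C_) ≡ 2 ^ s
∑-row zero    (suc n) _ = trans (∑-head n (0 C_)) (cong suc (∑-zero n))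
∑-row (suc s) (suc n) (s≤s s<n) = begin
  ∑ (suc n) (suc s C_)                     ≡⟨ ∑-head n (suc s C_) ⟩
  1 + ∑ n (λ i → suc s C suc i)            ≡⟨ cong suc (∑-cong n (λ i _ → pascal s i)) ⟩
  1 + ∑ n (λ i → s C i + s C suc i)        ≡⟨ cong suc (∑-+ n (s C_) (λ i → s C suc i)) ⟩
  1 + (∑ n (s C_) + ∑ n (λ i → s C suc i)) ≡⟨ sym (+-suc (∑ n (s C_)) _) ⟩
  ∑ n (s C_) + (1 + ∑ n (λ i → s C suc i)) ≡⟨ cong (∑ n (s C_) +_) (sym (∑-head n (s C_))) ⟩
  ∑ n (s C_) + ∑ (suc n) (s C_)            ≡⟨ cong₂ _+_ (∑-row s n s<n) (∑-row s (suc n) (m<n⇒m<1+n s<n)) ⟩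
  2 ^ s + 2 ^ s                            ≡⟨ cong (2 ^ s +_) (sym (+-identityʳ _)) ⟩
  2 ^ suc s                                ∎

-- The counting functions

-- #below q k and #proper q k count the words over k + 1 consecutive values
-- whose later letters are all ≥ or all ≤ each letter: those of length q + 1
-- whose first letter is not the top value, and those of length q other than
-- the constant word at the top value.
#below : ℕ → ℕ → ℕ
#below q k = 2 ^ q * ((q + k) C suc q)

#proper : ℕ → ℕ → ℕ
#proper zero    k = 0
#proper (suc q) k = #below q k + #proper q k

-- By induction on q: the hypothesis and `#below q j` are neighbours in one Pascal row, and their
-- sum equals the remaining term `#below q (suc j)`, so the power of 2 doubles.
#proper-step : ∀ q j → suc (#proper q (suc j) + #proper q j) ≡ 2 ^ q * ((q + j) C q)
#proper-step zero    j = refl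
#proper-step (suc q) j = begin
  suc ((#below q (suc j) + #proper q (suc j)) + (#below q j + #proper q j))
    ≡⟨ regroup (#below q (suc j)) (#proper q (suc j)) (#below q j) (#proper q j) ⟩
  #below q (suc j) + (suc (#proper q (suc j) + #proper q j) + #below q j)
    ≡⟨ cong (λ z → #below q (suc j) + (z + #below q j)) (#proper-step q j) ⟩
  #below q (suc j) + (2 ^ q * ((q + j) C q) + 2 ^ q * ((q + j) C suc q))
    ≡⟨ cong (#below q (suc j) +_) (sym (*-distribˡ-+ (2 ^ q) ((q + j) C q) _)) ⟩
  #below q (suc j) + 2 ^ q * ((q + j) C q + (q + j) C suc q)
    ≡⟨ cong (λ z → #below q (suc j) + 2 ^ q * z) (sym (pascal (q + j) q)) ⟩
  2 ^ q * ((q + suc j) C suc q) + 2 ^ q * ((suc q + j) C suc q)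
    ≡⟨ cong (λ z → 2 ^ q * (z C suc q) + 2 ^ q * ((suc q + j) C suc q)) (+-suc q j) ⟩
  2 ^ q * ((suc q + j) C suc q) + 2 ^ q * ((suc q + j) C suc q)
    ≡⟨ double (2 ^ q) ((suc q + j) C suc q) ⟩
  2 ^ suc q * ((suc q + j) C suc q) ∎
  where
  regroup : ∀ w x y z → suc ((w + x) + (y + z)) ≡ w + (suc (x + z) + y)
  regroup = solve-∀
  double : ∀ x y → x * y + x * y ≡ 2 * x * y
  double = solve-∀

-- The summand belongs to a first letter at height j: the later letters lie between it and the top,
-- or properly below it. Reversing the first of these two sums aligns them for `#proper-step`; a
-- hockey stick remains.
∑-#proper : ∀ q k → ∑ k (λ j → suc (#proper q (k ∸ j)) + #proper q j) ≡ #below q k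
∑-#proper q k = begin
  ∑ k (λ j → suc (#proper q (k ∸ j)) + #proper q j)     ≡⟨ ∑-+ k (λ j → suc (#proper q (k ∸ j))) (#proper q) ⟩
  ∑ k (λ j → suc (#proper q (k ∸ j))) + ∑ k (#proper q) ≡⟨ cong (_+ ∑ k (#proper q)) (∑-reverse k (λ j → suc (#proper q j))) ⟩
  ∑ k (λ j → suc (#proper q (suc j))) + ∑ k (#proper q) ≡⟨ sym (∑-+ k (λ j → suc (#proper q (suc j))) (#proper q)) ⟩
  ∑ k (λ j → suc (#proper q (suc j) + #proper q j))     ≡⟨ ∑-cong k (λ j _ → #proper-step q j) ⟩
  ∑ k (λ j → 2 ^ q * ((q + j) C q))                     ≡⟨ ∑-* k (2 ^ q) (λ j → (q + j) C q) ⟩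
  2 ^ q * ∑ k (λ j → (q + j) C q)                       ≡⟨ cong (2 ^ q *_) (column k) ⟩
  #below q k                                            ∎
  where
  column : ∀ k → ∑ k (λ j → (q + j) C q) ≡ (q + k) C suc q
  column zero    = sym (k>n⇒nCk≡0 (s≤s (≤-reflexive (+-identityʳ q))))
  column (suc k) = begin
    ∑ (suc k) (λ j → (q + j) C q) ≡⟨ ∑-cong (suc k) (λ j _ → cong (_C q) (+-comm q j)) ⟩
    ∑ (suc k) (λ j → (j + q) C q) ≡⟨ hockey-stick q k ⟩
    (k + suc q) C suc q           ≡⟨ cong (_C suc q) (trans (+-comm k (suc q)) (sym (+-suc q k))) ⟩
    (q + suc k) C suc q           ∎

-- Words of length r over k + 1 values, not constant at the top, that follow a
-- top letter of slack s and have their first descent at slack t.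
#falling : ℕ → ℕ → ℕ → ℕ → ℕ
#falling k zero    s t = 0
#falling k (suc r) s t = δ s t * #below r k + #falling k r (suc s) t

-- Rising continuations of length r from slack s, of final rank t.
#rising : ℕ → ℕ → ℕ → ℕ
#rising t zero    s = δ s t
#rising t (suc r) s = ∑ (2 + s) (λ i → #rising t r i + #falling (suc s ∸ i) r i t)

-- The number of ways to finish right after a strict ascent by k to the maximum,
-- with r letters left and no repetition of the maximum before the descent.
#peak : ℕ → ℕ → ℕ
#peak zero    zero    = 0
#peak zero    (suc k) = 1
#peak (suc q) k       = #below q k

-- The part of #rising whose first descent is preceded by a strict ascent.
#strict : ℕ → ℕ → ℕ → ℕ
#strict t zero    s = 0
#strict t (suc r) s = ∑ (2 + s) (λ i → #strict t r i + δ i t * #peak r (suc s ∸ i))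

-- Deleting a repeated maximum before the first descent

#falling-suc : ∀ k r s t → #falling k r (suc s) (suc t) ≡ #falling k r s t
#falling-suc k zero    s t = refl
#falling-suc k (suc r) s t = cong (δ s t * #below r k +_) (#falling-suc k r (suc s) t)

-- Repeating the top letter only raises the slack, so a positive slack cannot end at 0.
#falling-zero : ∀ k r s → #falling k r (suc s) 0 ≡ 0
#falling-zero k zero    s = refl
#falling-zero k (suc r) s = #falling-zero k r (suc s)

#falling-step : ∀ k r s t → #falling k (suc r) s (suc t) ≡ #falling k r s t + δ s (suc t) * #below r k
#falling-step k r s t = trans (+-comm (δ s (suc t) * #below r k) _) (cong (_+ δ s (suc t) * #below r k) (#falling-suc k r s t))

-- With one letter left, the index i = s + 1 repeats the maximum, and every smaller i is a strict
-- ascent, counted once by `#peak 0`.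
#rising-one : ∀ t s → #rising t 1 s ≡ δ (suc s) t + #strict t 1 s
#rising-one t s = begin
  ∑ (suc s) (λ i → δ i t + 0) + (δ (suc s) t + 0)
    ≡⟨ cong₂ _+_ (∑-cong (suc s) summand) (+-identityʳ _) ⟩
  ∑ (suc s) g + δ (suc s) t
    ≡⟨ +-comm (∑ (suc s) g) _ ⟩
  δ (suc s) t + ∑ (suc s) g
    ≡⟨ cong (δ (suc s) t +_) (sym (trans (cong (∑ (suc s) g +_) last) (+-identityʳ _))) ⟩
  δ (suc s) t + #strict t 1 s ∎
  where
  g : ℕ → ℕ
  g i = 0 + δ i t * #peak 0 (suc s ∸ i)
  summand : ∀ i → i < suc s → δ i t + 0 ≡ g i
  summand i (s≤s i≤s) = begin
    δ i t + 0                   ≡⟨ +-identityʳ _ ⟩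
    δ i t                       ≡⟨ sym (*-identityʳ _) ⟩
    δ i t * 1                   ≡⟨ cong (λ z → δ i t * #peak 0 z) (sym (+-∸-assoc 1 i≤s)) ⟩
    δ i t * #peak 0 (suc s ∸ i) ∎
  last : g (suc s) ≡ 0
  last = trans (cong (λ z → δ (suc s) t * #peak 0 z) (n∸n≡0 (suc s))) (*-zeroʳ (δ (suc s) t))

-- A repetition just before the first descent would make the slack there positive, so rank 0 forces
-- a strict ascent.
#rising-zero : ∀ r s → #rising 0 (suc r) s ≡ #strict 0 (suc r) s
#rising-zero zero    s = #rising-one 0 s
#rising-zero (suc r) s = ∑-cong (2 + s) λ i _ → cong₂ _+_ (#rising-zero r i)
  (trans (cong (δ i 0 * #below r (suc s ∸ i) +_) (#falling-zero (suc s ∸ i) r i)) (+-identityʳ _))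

-- Either the letter at the first descent equals its predecessor, and deleting one copy lowers
-- length and final slack by one, or it is reached by a strict ascent. `#falling-step` makes this
-- split after each possible maximum.
#rising-suc : ∀ t r s → #rising (suc t) (suc r) s ≡ #rising t r s + #strict (suc t) (suc r) s
#rising-suc t zero    s = #rising-one (suc t) s
#rising-suc t (suc r) s = begin
  ∑ (2 + s) (λ i → #rising (suc t) (suc r) i + #falling (suc s ∸ i) (suc r) i (suc t))
    ≡⟨ ∑-cong (2 + s) (λ i _ → cong₂ _+_ (#rising-suc t r i) (#falling-step (suc s ∸ i) r i t)) ⟩
  ∑ (2 + s) (λ i → (#rising t r i + #strict (suc t) (suc r) i) + (#falling (suc s ∸ i) r i t + δ i (suc t) * #below r (suc s ∸ i)))
    ≡⟨ ∑-cong (2 + s) (λ i _ → interchange (#rising t r i) _ _ _) ⟩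
  ∑ (2 + s) (λ i → (#rising t r i + #falling (suc s ∸ i) r i t) + (#strict (suc t) (suc r) i + δ i (suc t) * #below r (suc s ∸ i)))
    ≡⟨ ∑-+ (2 + s) (λ i → #rising t r i + #falling (suc s ∸ i) r i t) _ ⟩
  #rising t (suc r) s + #strict (suc t) (suc (suc r)) s ∎

-- Ballot numbers and the closed form

ω : ℕ → ℕ
ω zero    = 1
ω (suc q) = 2 ^ q

-- ballot r u s counts the weakly increasing continuations of length r that take
-- the slack from s to u; since a letter raises the slack by at most 1, the
-- constraint slack ≥ 0 is vacuous for u ≥ r.
ballot : ℕ → ℕ → ℕ → ℕ
ballot zero    u s = δ s u
ballot (suc r) u s = ∑ (2 + s) (ballot r u)

-- The final slack fixes the last letter, which is s - v above the starting one; the r letters in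
-- between form a multiset over the s - v + 1 values of that range.
ballot-free : ∀ r v s → ballot (suc r) (suc (v + r)) s ≡ shift v (λ m → (m + r) C r) s
ballot-free r v s = begin
  ∑ (2 + s) (ballot r (suc (v + r))) ≡⟨ summand r ⟩
  -- The term i = 0 vanishes: r letters cannot raise the slack from 0 to v + r + 1.
  ∑ (2 + s) (shift (suc v) (g r))    ≡⟨ ∑-head (suc s) (shift (suc v) (g r)) ⟩
  ∑ (suc s) (shift v (g r))          ≡⟨ ∑-shift v s (g r) ⟩
  shift v (λ m → ∑ (suc m) (g r)) s  ≡⟨ shift-cong v s (col r) ⟩
  shift v (λ m → (m + r) C r) s      ∎
  where
  g : ℕ → ℕ → ℕ
  g zero    = isZero
  g (suc r) = λ m → (m + r) C r
  summand : ∀ r → ∑ (2 + s) (ballot r (suc (v + r))) ≡ ∑ (2 + s) (shift (suc v) (g r))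
  summand zero    = cong (λ z → ∑ (2 + s) (ballot 0 (suc z))) (+-identityʳ v)
  summand (suc r) = ∑-cong (2 + s) λ i _ →
    trans (cong (λ z → ballot (suc r) (suc z) i) (+-suc v r)) (ballot-free r (suc v) i)
  col : ∀ r m → ∑ (suc m) (g r) ≡ (m + r) C r
  col zero    m = trans (∑-head m isZero) (cong suc (∑-zero m))
  col (suc r) m = hockey-stick r m

-- The binomial counts r-multisets of the s + 1 values below the maximum and not below its
-- predecessor; the weight is 2 ^ (r - 1), read as 1 for r = 0.
#peak-suc : ∀ r s → #peak r (suc s) ≡ ω r * ((s + r) C r)
#peak-suc zero    s = refl
#peak-suc (suc q) s = cong (λ z → 2 ^ q * (z C suc q))
  (trans (+-suc q s) (trans (cong suc (+-comm q s)) (sym (+-suc s q))))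

#peak-zero : ∀ r → #peak r 0 ≡ 0
#peak-zero zero    = refl
#peak-zero (suc q) = trans (cong (2 ^ q *_) (k>n⇒nCk≡0 (s≤s (≤-reflexive (+-identityʳ q))))) (*-zeroʳ (2 ^ q))

-- The delta selects i = t. For t = s + 1 the ascent has height 0, and `#peak-zero` matches the 0 of
-- `shift`.
∑-#peak : ∀ r t s → ∑ (2 + s) (λ i → δ i t * #peak r (suc s ∸ i)) ≡ ω r * shift t (λ m → (m + r) C r) s
∑-#peak r zero s = begin
  ∑ (2 + s) (λ i → isZero i * #peak r (suc s ∸ i)) ≡⟨ ∑-head (suc s) (λ i → isZero i * #peak r (suc s ∸ i)) ⟩
  (#peak r (suc s) + 0) + ∑ (suc s) (λ _ → 0)      ≡⟨ cong₂ _+_ (+-identityʳ _) (∑-zero (suc s)) ⟩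
  #peak r (suc s) + 0                              ≡⟨ +-identityʳ _ ⟩
  #peak r (suc s)                                  ≡⟨ #peak-suc r s ⟩
  ω r * ((s + r) C r)                              ∎
∑-#peak r (suc t) zero    =
  trans (cong (δ 0 t *_) (#peak-zero r)) (trans (*-zeroʳ (δ 0 t)) (sym (*-zeroʳ (ω r))))
∑-#peak r (suc t) (suc s) =
  trans (∑-head (2 + s) (λ i → δ i (suc t) * #peak r (2 + s ∸ i))) (∑-#peak r t s)

-- Let q letters follow the maximum. Trade them for a q-multiset of smaller values, written in
-- increasing order and followed by the maximum lowered by one. The word becomes weakly increasing,
-- and its last letter is one lower and q places later, hence has slack t + q + 1.
#strict-sum : ∀ t r s → #strict t r s ≡ ∑ r (λ q → ω q * ballot r (suc (t + q)) s)
#strict-sum t zero    s = refl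
#strict-sum t (suc r) s = begin
  ∑ (2 + s) (λ i → #strict t r i + δ i t * #peak r (suc s ∸ i))
    ≡⟨ ∑-+ (2 + s) (#strict t r) _ ⟩
  ∑ (2 + s) (#strict t r) + ∑ (2 + s) (λ i → δ i t * #peak r (suc s ∸ i))
    ≡⟨ cong₂ _+_ (∑-cong (2 + s) (λ i _ → #strict-sum t r i)) (∑-#peak r t s) ⟩
  ∑ (2 + s) (λ i → ∑ r (λ q → ω q * ballot r (suc (t + q)) i)) + ω r * shift t (λ m → (m + r) C r) s
    ≡⟨ cong₂ _+_ (∑-swap (2 + s) r (λ i q → ω q * ballot r (suc (t + q)) i)) (cong (ω r *_) (sym (ballot-free r t s))) ⟩
  ∑ r (λ q → ∑ (2 + s) (λ i → ω q * ballot r (suc (t + q)) i)) + ω r * ballot (suc r) (suc (t + r)) s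
    ≡⟨ cong (_+ ω r * ballot (suc r) (suc (t + r)) s) (∑-cong r (λ q _ → ∑-* (2 + s) (ω q) (ballot r (suc (t + q))))) ⟩
  ∑ (suc r) (λ q → ω q * ballot (suc r) (suc (t + q)) s) ∎

-- A window of n entries in row x - t of Pascal's triangle, the shape that the weighted ballot sums
-- keep under their recursion.
row : ℕ → ℕ → ℕ → ℕ → ℕ
row n t x k = ∑ n (λ i → shift t (_C (k + i)) x)

row-pascal : ∀ n t x k → row n t (suc x) (suc k) ≡ row n t x k + row n t x (suc k)
row-pascal n t x k = trans (∑-cong n (λ i _ → shift-pascal t x (k + i)))
  (∑-+ n (λ i → shift t (_C (k + i)) x) (λ i → shift t (_C (suc k + i)) x))

-- The sum telescopes: the last entry of each new summand extends the accumulated window to the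
-- length of what is left of that summand, and Pascal's rule merges both windows into one in the
-- next row.
∑-rows : ∀ t x r s → ∑ (2 + s) (λ i → row (2 + i) t (x + i) r) ≡ row (2 + s) t (2 + x + s) (suc r)
∑-rows t x r zero = begin
  row 2 t (x + 0) r + row 3 t (x + 1) r
    ≡⟨ cong₂ (λ y z → row 2 t y r + row 3 t z r) (+-identityʳ x) (+-comm x 1) ⟩
  row 2 t x r + (row 2 t (suc x) r + p (suc x) (r + 2))
    ≡⟨ cong₂ (λ y z → (p x (r + 0) + p x y) + (row 2 t (suc x) r + p (suc x) z)) (+-suc r 0) (+-suc r 1) ⟩
  (p x (r + 0) + p x (suc r + 0)) + (row 2 t (suc x) r + p (suc x) (suc r + 1))
    ≡⟨ cong (_+ (row 2 t (suc x) r + p (suc x) (suc r + 1))) (sym (shift-pascal t x (r + 0))) ⟩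
  p (suc x) (suc r + 0) + (row 2 t (suc x) r + p (suc x) (suc r + 1))
    ≡⟨ x∙yz≈y∙xz (p (suc x) (suc r + 0)) (row 2 t (suc x) r) _ ⟩
  row 2 t (suc x) r + row 2 t (suc x) (suc r)
    ≡⟨ sym (row-pascal 2 t (suc x) r) ⟩
  row 2 t (2 + x) (suc r)
    ≡⟨ cong (λ z → row 2 t (2 + z) (suc r)) (sym (+-identityʳ x)) ⟩
  row 2 t (2 + x + 0) (suc r) ∎
  where
  p : ℕ → ℕ → ℕ
  p x k = shift t (_C k) x
∑-rows t x r (suc s) = begin
  ∑ (2 + s) (λ i → row (2 + i) t (x + i) r) + row (4 + s) t (x + (2 + s)) r
    ≡⟨ cong₂ _+_ (∑-rows t x r s) (cong (λ z → row (4 + s) t z r) (trans (+-suc x (suc s)) (cong suc (+-suc x s)))) ⟩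
  row (2 + s) t y (suc r) + (row (3 + s) t y r + shift t (_C (r + (3 + s))) y)
    ≡⟨ cong (λ z → row (2 + s) t y (suc r) + (row (3 + s) t y r + shift t (_C z) y)) (+-suc r (2 + s)) ⟩
  row (2 + s) t y (suc r) + (row (3 + s) t y r + shift t (_C (suc r + (2 + s))) y)
    ≡⟨ x∙yz≈y∙xz (row (2 + s) t y (suc r)) (row (3 + s) t y r) _ ⟩
  row (3 + s) t y r + row (3 + s) t y (suc r)
    ≡⟨ sym (row-pascal (3 + s) t y r) ⟩
  row (3 + s) t (suc y) (suc r)
    ≡⟨ cong (λ z → row (3 + s) t (2 + z) (suc r)) (sym (+-suc x s)) ⟩
  row (3 + s) t (2 + x + suc s) (suc r) ∎
  where
  y : ℕ
  y = 2 + x + s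

row-zero : ∀ n t s → s < n → row n t s 0 ≡ shift t (2 ^_) s
row-zero n zero    s       s<n = ∑-row s n s<n
row-zero n (suc t) zero    s<n = ∑-zero n
row-zero n (suc t) (suc s) s<n = row-zero n t s (<-trans (n<1+n s) s<n)

∑-2^ : ∀ s Q → s < Q → suc (∑ Q (λ q → 2 ^ q * shift q (λ _ → 1) s)) ≡ 2 ^ suc s
∑-2^ zero    (suc Q) _ = cong suc (trans (∑-head Q (λ q → 2 ^ q * shift q (λ _ → 1) 0))
  (cong suc (trans (∑-cong Q (λ q _ → *-zeroʳ (2 ^ suc q))) (∑-zero Q))))
∑-2^ (suc s) (suc Q) (s≤s s<Q) = begin
  suc (∑ (suc Q) (λ q → 2 ^ q * shift q (λ _ → 1) (suc s)))
    ≡⟨ cong suc (∑-head Q (λ q → 2 ^ q * shift q (λ _ → 1) (suc s))) ⟩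
  2 + ∑ Q (λ q → 2 * 2 ^ q * shift q (λ _ → 1) s)
    ≡⟨ cong (2 +_) (trans (∑-cong Q (λ q _ → *-assoc 2 (2 ^ q) _)) (∑-* Q 2 (λ q → 2 ^ q * shift q (λ _ → 1) s))) ⟩
  2 + 2 * ∑ Q (λ q → 2 ^ q * shift q (λ _ → 1) s)
    ≡⟨ sym (*-suc 2 _) ⟩
  2 * suc (∑ Q (λ q → 2 ^ q * shift q (λ _ → 1) s))
    ≡⟨ cong (2 *_) (∑-2^ s Q s<Q) ⟩
  2 ^ suc (suc s) ∎

-- The weight `ω 0` supplies the extra 1 in 1 + (1 + 2 + ⋯ + 2 ^ (m - 1)) = 2 ^ m, where m = s - t.
∑-ω : ∀ t s Q → s < t + Q → ∑ Q (λ q → ω q * shift (t + q) (λ _ → 1) s) ≡ shift t (2 ^_) s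
∑-ω zero    zero    (suc Q) _ = trans (∑-head Q (λ q → ω q * shift q (λ _ → 1) 0))
  (cong suc (trans (∑-cong Q (λ q _ → *-zeroʳ (2 ^ q))) (∑-zero Q)))
∑-ω zero    (suc s) (suc Q) (s≤s s<Q) = trans (∑-head Q (λ q → ω q * shift q (λ _ → 1) (suc s))) (∑-2^ s Q s<Q)
∑-ω (suc t) zero    Q       _ = trans (∑-cong Q (λ q _ → *-zeroʳ (ω q))) (∑-zero Q)
∑-ω (suc t) (suc s) Q (s≤s s<) = ∑-ω t s Q s<

-- The hypothesis says that ballot (suc r) (suc (t + q)) s vanishes for q ≥ Q, so
-- that the recursion in r needs no source term.
∑-ω-ballot : ∀ t Q r s → s + suc r ≤ t + Q →
        ∑ Q (λ q → ω q * ballot (suc r) (suc (t + q)) s) ≡ row (2 + s) t (2 * r + s) r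
∑-ω-ballot t Q zero    s s≤ = begin
  ∑ Q (λ q → ω q * ballot 1 (suc (t + q)) s)
    ≡⟨ ∑-cong Q (λ q _ → cong (ω q *_) (trans (cong (λ z → ballot 1 (suc z) s) (sym (+-identityʳ (t + q)))) (ballot-free 0 (t + q) s))) ⟩
  ∑ Q (λ q → ω q * shift (t + q) (λ _ → 1) s)
    ≡⟨ ∑-ω t s Q s<t+Q ⟩
  shift t (2 ^_) s
    ≡⟨ sym (row-zero (2 + s) t s (m<n⇒m<1+n (n<1+n s))) ⟩
  row (2 + s) t s 0 ∎
  where
  s<t+Q : s < t + Q
  s<t+Q = subst (_≤ t + Q) (+-comm s 1) s≤
∑-ω-ballot t Q (suc r) s s≤ = begin
  ∑ Q (λ q → ω q * ballot (2 + r) (suc (t + q)) s)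
    ≡⟨ ∑-cong Q (λ q _ → sym (∑-* (2 + s) (ω q) (ballot (suc r) (suc (t + q))))) ⟩
  ∑ Q (λ q → ∑ (2 + s) (λ i → ω q * ballot (suc r) (suc (t + q)) i))
    ≡⟨ ∑-swap Q (2 + s) (λ q i → ω q * ballot (suc r) (suc (t + q)) i) ⟩
  ∑ (2 + s) (λ i → ∑ Q (λ q → ω q * ballot (suc r) (suc (t + q)) i))
    ≡⟨ ∑-cong (2 + s) (λ i i<2+s → ∑-ω-ballot t Q r i (bound i i<2+s)) ⟩
  ∑ (2 + s) (λ i → row (2 + i) t (2 * r + i) r)
    ≡⟨ ∑-rows t (2 * r) r s ⟩
  row (2 + s) t (2 + 2 * r + s) (suc r)
    ≡⟨ cong (λ z → row (2 + s) t (z + s) (suc r)) (sym (*-suc 2 r)) ⟩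
  row (2 + s) t (2 * suc r + s) (suc r) ∎
  where
  -- A letter raises the slack by at most one and uses up one letter, so slack plus remaining length
  -- does not grow.
  bound : ∀ i → i < 2 + s → i + suc r ≤ t + Q
  bound i (s≤s i≤) = ≤-trans (+-monoˡ-≤ (suc r) i≤) (≤-trans (≤-reflexive (sym (+-suc s (suc r)))) s≤)

-- From slack 0 the window has two adjacent entries, and Pascal's rule joins them.
#strict-closed : ∀ t r → #strict t (suc r) 0 ≡ shift t (_C suc r) (suc (2 * r))
#strict-closed t r = begin
  #strict t (suc r) 0                                    ≡⟨ #strict-sum t (suc r) 0 ⟩
  ∑ (suc r) (λ q → ω q * ballot (suc r) (suc (t + q)) 0) ≡⟨ ∑-ω-ballot t (suc r) r 0 (m≤n+m (suc r) t) ⟩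
  row 2 t (2 * r + 0) r                                  ≡⟨ cong (λ z → row 2 t z r) (+-identityʳ (2 * r)) ⟩
  shift t (_C (r + 0)) (2 * r) + shift t (_C (r + 1)) (2 * r)
    ≡⟨ cong₂ (λ y z → shift t (_C y) (2 * r) + shift t (_C z) (2 * r)) (+-identityʳ r) (+-comm r 1) ⟩
  shift t (_C r) (2 * r) + shift t (_C suc r) (2 * r) ≡⟨ sym (shift-pascal t (2 * r) r) ⟩
  shift t (_C suc r) (suc (2 * r))                    ∎

-- Induction on t with a fixed, since `#rising-suc` lowers length and rank together; each step adds
-- one term of the hockey stick. At t = 0 two equal middle binomials add up to the central one. The
-- additive form stays within ℕ.
#rising-closed : ∀ t a → #rising t (suc (a + t)) 0 + (suc (2 * a) C suc a) ≡ (2 + 2 * a + t) C suc a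
#rising-closed zero a = begin
  #rising 0 (suc (a + 0)) 0 + (suc (2 * a) C suc a)
    ≡⟨ cong (λ z → #rising 0 (suc z) 0 + (suc (2 * a) C suc a)) (+-identityʳ a) ⟩
  #rising 0 (suc a) 0 + (suc (2 * a) C suc a)
    ≡⟨ cong (_+ (suc (2 * a) C suc a)) (trans (#rising-zero a 0) (#strict-closed 0 a)) ⟩
  (suc (2 * a) C suc a) + (suc (2 * a) C suc a)
    ≡⟨ cong (_+ (suc (2 * a) C suc a)) (subst (λ n → n C suc a ≡ n C a) (size a) (C-symm (suc a) a)) ⟩
  (suc (2 * a) C a) + (suc (2 * a) C suc a)
    ≡⟨ sym (pascal (suc (2 * a)) a) ⟩
  (2 + 2 * a) C suc a
    ≡⟨ cong (_C suc a) (sym (+-identityʳ (2 + 2 * a))) ⟩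
  (2 + 2 * a + 0) C suc a ∎
  where
  size : ∀ a → suc a + a ≡ suc (2 * a)
  size = solve-∀
#rising-closed (suc t) a = begin
  #rising (suc t) (suc (a + suc t)) 0 + c
    ≡⟨ cong (_+ c) (#rising-suc t (a + suc t) 0) ⟩
  #rising t (a + suc t) 0 + #strict (suc t) (suc (a + suc t)) 0 + c
    ≡⟨ cong₂ (λ y z → #rising t y 0 + z + c) (+-suc a t) new ⟩
  #rising t (suc (a + t)) 0 + n C a + c
    ≡⟨ rotate (#rising t (suc (a + t)) 0) (n C a) c ⟩
  n C a + (#rising t (suc (a + t)) 0 + c)
    ≡⟨ cong (n C a +_) (#rising-closed t a) ⟩
  n C a + n C suc a
    ≡⟨ sym (pascal n a) ⟩
  suc n C suc a
    ≡⟨ cong (_C suc a) (sym (+-suc (2 + 2 * a) t)) ⟩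
  (2 + 2 * a + suc t) C suc a ∎
  where
  c n : ℕ
  c = suc (2 * a) C suc a
  n = 2 + 2 * a + t
  rotate : ∀ x y z → x + y + z ≡ y + (x + z)
  rotate = solve-∀
  size : ∀ a t → suc (2 * (a + suc t)) ≡ suc t + (2 + 2 * a + t)
  size = solve-∀
  size′ : ∀ a t → suc (a + suc t) + a ≡ 2 + 2 * a + t
  size′ = solve-∀
  new : #strict (suc t) (suc (a + suc t)) 0 ≡ n C a
  new = begin
    #strict (suc t) (suc (a + suc t)) 0                        ≡⟨ #strict-closed (suc t) (a + suc t) ⟩
    shift (suc t) (_C suc (a + suc t)) (suc (2 * (a + suc t))) ≡⟨ cong (shift (suc t) (_C suc (a + suc t))) (size a t) ⟩
    shift (suc t) (_C suc (a + suc t)) (suc t + n)             ≡⟨ shift-+ (suc t) n (_C suc (a + suc t)) ⟩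
    n C suc (a + suc t)                                        ≡⟨ subst (λ m → m C suc (a + suc t) ≡ m C a) (size′ a t) (C-symm (suc (a + suc t)) a) ⟩
    n C a                                                      ∎

-- Counting by first letter

open import Data.Integer.Base using (+_)

Counted : {A : Set} → Pred A 0ℓ → ℕ → Set
Counted P n = NumberOf P Is (+ n)

private
  variable
    A : Set
    P Q : Pred A 0ℓ
    m n : ℕ

counted-cong : (∀ x → P x ⇔ Q x) → Counted P n → Counted Q n
counted-cong P⇔Q (xs , uniq , mem , len) =
  xs , uniq , (λ x → mk⇔ (to (P⇔Q x) ∘ to (mem x)) (from (mem x) ∘ from (P⇔Q x))) , len

counted-∅ : (∀ x → ¬ P x) → Counted P 0
counted-∅ ¬P = [] , [] , (λ x → mk⇔ (λ ()) (λ px → contradiction px (¬P x))) , refl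

counted-singleton : (a : A) → Counted (_≡ a) 1
counted-singleton a =
  a ∷ [] , ListAll.[] ∷ [] , (λ x → mk⇔ (λ { (here eq) → eq ; (there ()) }) here) , refl

counted-⊎ : (∀ x → P x → ¬ Q x) → Counted P m → Counted Q n →
            Counted (λ x → P x ⊎ Q x) (m + n)
counted-⊎ disjoint (xs , xs! , xs∈ , xs-length) (ys , ys! , ys∈ , ys-length) =
  xs ++ ys ,
  Unique.++⁺ xs! ys! (λ { {x} (x∈xs , x∈ys) → disjoint x (to (xs∈ x) x∈xs) (to (ys∈ x) x∈ys) }) ,
  (λ x → mk⇔ (Sum.map (to (xs∈ x)) (to (ys∈ x)) ∘ ∈-++⁻ xs)
             [ ∈-++⁺ˡ ∘ from (xs∈ x) , ∈-++⁺ʳ xs ∘ from (ys∈ x) ]′) ,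
  cong +_ (trans (length-++ xs) (cong₂ _+_ (ℤ.+-injective xs-length) (ℤ.+-injective ys-length)))

counted-when : ∀ s t → Counted P n → Counted (λ x → P x × s ≡ t) (δ s t * n)
counted-when {P = P} {n = n} s t counted with s ≟ t
... | yes refl = subst (Counted _) (sym (trans (cong (_* n) (δ-refl s)) (*-identityˡ n)))
  (counted-cong (λ x → mk⇔ (_, refl) proj₁) counted)
  where
  δ-refl : ∀ s → δ s s ≡ 1
  δ-refl zero    = refl
  δ-refl (suc s) = δ-refl s
... | no s≢t = subst (Counted _) (sym (cong (_* n) (δ-≢ s t s≢t))) (counted-∅ (λ x → s≢t ∘ proj₂))
  where
  δ-≢ : ∀ s t → s ≢ t → δ s t ≡ 0
  δ-≢ zero    zero    s≢t = contradiction refl s≢t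
  δ-≢ zero    (suc t) s≢t = refl
  δ-≢ (suc s) zero    s≢t = refl
  δ-≢ (suc s) (suc t) s≢t = δ-≢ s t (s≢t ∘ cong suc)

counted-head : (P : Pred (Vec A (suc n)) 0ℓ) (x : A) → Counted (λ xs → P (x ∷ xs)) m →
               Counted (λ v → P v × head v ≡ x) m
counted-head P x (xss , uniq , mem , len) =
  map (x ∷_) xss , Unique.map⁺ ∷-injectiveʳ uniq , mem′ , trans (cong +_ (length-map (x ∷_) xss)) len
  where
  mem′ : ∀ v → v ∈ map (x ∷_) xss ⇔ (P v × head v ≡ x)
  mem′ (y ∷ ys) = mk⇔ sound complete
    where
    sound : y ∷ ys ∈ map (x ∷_) xss → P (y ∷ ys) × y ≡ x
    sound v∈ with ∈-map⁻ (x ∷_) v∈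
    ... | xs , xs∈ , refl = to (mem xs) xs∈ , refl
    complete : P (y ∷ ys) × y ≡ x → y ∷ ys ∈ map (x ∷_) xss
    complete (p , refl) = ∈-map⁺ (x ∷_) (from (mem ys) p)

counted-heads : (P : Pred (Vec A (suc n)) 0ℓ) (g : ℕ → A) (c : ℕ → ℕ) (k : ℕ) →
                (∀ {i j} → i < k → j < k → g i ≡ g j → i ≡ j) →
                (∀ i → i < k → Counted (λ xs → P (g i ∷ xs)) (c i)) →
                Counted (λ v → P v × ∃[ i ] i < k × head v ≡ g i) (∑ k c)
counted-heads P g c zero    inj counted = counted-∅ (λ { x (_ , _ , () , _) })
counted-heads P g c (suc k) inj counted = counted-cong (λ v → mk⇔ merge split)
  (counted-⊎ disjoint
    (counted-heads P g c k (λ i<k j<k → inj (m<n⇒m<1+n i<k) (m<n⇒m<1+n j<k))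
      (λ i i<k → counted i (m<n⇒m<1+n i<k)))
    (counted-head P (g k) (counted k ≤-refl)))
  where
  disjoint : ∀ v → P v × ∃[ i ] i < k × head v ≡ g i → ¬ (P v × head v ≡ g k)
  disjoint v (_ , i , i<k , eq) (_ , eq′) =
    <⇒≢ i<k (inj (m<n⇒m<1+n i<k) ≤-refl (trans (sym eq) eq′))
  merge : ∀ {v} → (P v × ∃[ i ] i < k × head v ≡ g i) ⊎ (P v × head v ≡ g k) →
          P v × ∃[ i ] i < suc k × head v ≡ g i
  merge (inj₁ (p , i , i<k , eq)) = p , i , m<n⇒m<1+n i<k , eq
  merge (inj₂ (p , eq))           = p , k , ≤-refl , eq
  split : ∀ {v} → P v × ∃[ i ] i < suc k × head v ≡ g i →
          (P v × ∃[ i ] i < k × head v ≡ g i) ⊎ (P v × head v ≡ g k)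
  split (p , i , s≤s i≤k , eq) with m≤n⇒m<n∨m≡n i≤k
  ... | inj₁ i<k  = inj₁ (p , i , i<k , eq)
  ... | inj₂ refl = inj₂ (p , eq)

-- Avoidance of 102 and 120

OneSided : Vec ℕ n → Set
OneSided []       = ⊤
OneSided (x ∷ xs) = (All (x ≤_) xs ⊎ All (_≤ x) xs) × OneSided xs

oneSided-lookup : (e : Vec ℕ n) → OneSided e → ∀ i →
                  (∀ j → i Fin.< j → lookup e i ≤ lookup e j) ⊎
                  (∀ j → i Fin.< j → lookup e j ≤ lookup e i)
oneSided-lookup (x ∷ xs) (split , _) zero = Sum.map (after {R = x ≤_}) (after {R = _≤ x}) split
  where
  after : ∀ {R : Pred ℕ 0ℓ} → All R xs → ∀ j → 0 < toℕ j → R (lookup (x ∷ xs) j)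
  after all (suc j) _ = Allₚ.lookup⁺ all j
oneSided-lookup (x ∷ xs) (_ , os) (suc i) =
  Sum.map (later {R = lookup xs i ≤_}) (later {R = _≤ lookup xs i}) (oneSided-lookup xs os i)
  where
  later : ∀ {R : ℕ → Set} → (∀ j → i Fin.< j → R (lookup xs j)) →
          ∀ j → suc i Fin.< j → R (lookup (x ∷ xs) j)
  later r (suc j) (s≤s i<j) = r j i<j

-- The first entry of the pattern lies strictly between the two later ones, which contradicts either
-- side; the same holds for 120.
oneSided⇒avoids102 : (e : Vec ℕ n) → OneSided e → Avoids e pattern102
oneSided⇒avoids102 e os (i , j , k , i<j , j<k , iso) with oneSided-lookup e os i
... | inj₁ up   = <⇒≱ (from (proj₁ (iso (suc zero) zero)) (s≤s z≤n)) (up j i<j)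
... | inj₂ down = <⇒≱ (from (proj₁ (iso zero (suc (suc zero)))) (s≤s (s≤s z≤n))) (down k (<-trans i<j j<k))

oneSided⇒avoids120 : (e : Vec ℕ n) → OneSided e → Avoids e pattern120
oneSided⇒avoids120 e os (i , j , k , i<j , j<k , iso) with oneSided-lookup e os i
... | inj₁ up   = <⇒≱ (from (proj₁ (iso (suc (suc zero)) zero)) (s≤s z≤n)) (up k (<-trans i<j j<k))
... | inj₂ down = <⇒≱ (from (proj₁ (iso zero (suc zero))) (s≤s (s≤s z≤n))) (down j i<j)

orderIsomorphic-map : (φ : ℕ → ℕ) → (∀ {x y} → x < y → φ x < φ y) →
                      (w : Vec ℕ m) → OrderIsomorphic (Vec.map φ w) w
orderIsomorphic-map φ mono w i j
  rewrite lookup-map i φ w | lookup-map j φ w with <-cmp (lookup w i) (lookup w j)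
... | tri< lt ≢ _ = mk⇔ (λ _ → lt) mono , mk⇔ (λ eq → contradiction eq (<⇒≢ (mono lt))) (λ eq → contradiction eq ≢)
... | tri≈ ≮ eq _ = mk⇔ (λ lt → contradiction (cong φ eq) (<⇒≢ lt)) (λ lt → contradiction lt ≮) , mk⇔ (λ _ → eq) (cong φ)
... | tri> ≮ ≢ gt = mk⇔ (λ lt → contradiction lt (<⇒≯ (mono gt))) (λ lt → contradiction lt ≮) ,
                    mk⇔ (λ eq → contradiction (sym eq) (<⇒≢ (mono gt))) (λ eq → contradiction eq ≢)

module _ {x y z : ℕ} (x<y : x < y) (y<z : y < z) where

  -- Continuing past 2 by z + i makes the map strictly increasing on all of ℕ, as
  -- `orderIsomorphic-map` requires.
  threeValues : ℕ → ℕ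
  threeValues 0             = x
  threeValues 1             = y
  threeValues (suc (suc i)) = z + i

  threeValues-mono : ∀ {i j} → i < j → threeValues i < threeValues j
  threeValues-mono {0}           {1}           _ = x<y
  threeValues-mono {0}           {suc (suc j)} _ = <-≤-trans (<-trans x<y y<z) (m≤m+n z j)
  threeValues-mono {1}           {1}           (s≤s ())
  threeValues-mono {1}           {suc (suc j)} _ = <-≤-trans y<z (m≤m+n z j)
  threeValues-mono {suc (suc i)} {1}           (s≤s ())
  threeValues-mono {suc (suc i)} {suc (suc j)} (s≤s (s≤s i<j)) = +-monoʳ-< z i<j

  iso102 : OrderIsomorphic (y ∷ x ∷ z ∷ []) pattern102
  -- The map sends 2 to `z + 0`.
  iso102 = subst (λ u → OrderIsomorphic (y ∷ x ∷ u ∷ []) pattern102) (+-identityʳ z)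
    (orderIsomorphic-map threeValues threeValues-mono pattern102)

  iso120 : OrderIsomorphic (y ∷ z ∷ x ∷ []) pattern120
  iso120 = subst (λ u → OrderIsomorphic (y ∷ u ∷ x ∷ []) pattern120) (+-identityʳ z)
    (orderIsomorphic-map threeValues threeValues-mono pattern120)

avoids-tail : ∀ {w x} (xs : Vec ℕ n) → Avoids (x ∷ xs) w → Avoids xs w
avoids-tail xs avoids (i , j , k , i<j , j<k , iso) = avoids (suc i , suc j , suc k , s≤s i<j , s≤s j<k , iso)

-- If both a smaller and a larger letter follow x, then the order in which they occur yields 102 or
-- 120.
avoids⇒oneSided : (e : Vec ℕ n) → Avoids e pattern102 → Avoids e pattern120 → OneSided e
avoids⇒oneSided []       _  _  = tt
avoids⇒oneSided (x ∷ xs) a₁ a₂ = split , avoids⇒oneSided xs (avoids-tail {w = pattern102} xs a₁) (avoids-tail {w = pattern120} xs a₂)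
  where
  split : All (x ≤_) xs ⊎ All (_≤ x) xs
  split with All.decide (λ y → ≤-<-connex x y) xs | All.decide (λ y → ≤-<-connex y x) xs
  ... | inj₁ up | _         = inj₁ up
  ... | inj₂ _  | inj₁ down = inj₂ down
  ... | inj₂ lo | inj₂ hi   = contradiction-of (Fin.<-cmp (Any.index lo) (Any.index hi))
    where
    lo< : lookup xs (Any.index lo) < x
    lo< = lookup-index lo
    hi> : x < lookup xs (Any.index hi)
    hi> = lookup-index hi
    contradiction-of : _ → _
    contradiction-of (tri< i<j _ _) = contradiction (zero , suc (Any.index lo) , suc (Any.index hi) , s≤s z≤n , s≤s i<j , iso102 lo< hi>) a₁
    contradiction-of (tri≈ _ i≡j _) = contradiction (<-trans lo< hi>) (<-irrefl (cong (lookup xs) i≡j))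
    contradiction-of (tri> _ _ j<i) = contradiction (zero , suc (Any.index hi) , suc (Any.index lo) , s≤s z≤n , s≤s j<i , iso120 lo< hi>) a₂

-- Words confined between two values

Between : ℕ → ℕ → Vec ℕ n → Set
Between lo hi xs = All (lo ≤_) xs × All (_≤ hi) xs × OneSided xs

-- Leaving out the constant word at `hi`, and with it the empty word, makes the two alternatives of
-- `between-∷` exclusive.
Proper : ℕ → ℕ → Vec ℕ n → Set
Proper lo hi xs = Between lo hi xs × ¬ All (hi ≤_) xs

between-∷ : ∀ {lo hi x} (xs : Vec ℕ n) → lo ≤ x → x ≤ hi →
            Between lo hi (x ∷ xs) ⇔ (Between x hi xs ⊎ Proper lo x xs)
between-∷ {lo = lo} {hi} {x} xs lo≤x x≤hi = mk⇔ split merge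
  where
  split : Between lo hi (x ∷ xs) → Between x hi xs ⊎ Proper lo x xs
  split (_ ∷ ge , _ ∷ le , side , os) with All.all? (x ≤?_) xs | side
  ... | yes up | _         = inj₁ (up , le , os)
  ... | no ¬up | inj₁ up   = contradiction up ¬up
  ... | no ¬up | inj₂ down = inj₂ ((ge , down , os) , ¬up)
  merge : Between x hi xs ⊎ Proper lo x xs → Between lo hi (x ∷ xs)
  merge (inj₁ (up , le , os)) = lo≤x ∷ All.map (≤-trans lo≤x) up , x≤hi ∷ le , inj₁ up , os
  merge (inj₂ ((ge , down , os) , _)) =
    lo≤x ∷ ge , x≤hi ∷ All.map (λ y≤x → ≤-trans y≤x x≤hi) down , inj₂ down , os

between-top : ∀ {lo hi} → lo ≤ hi → (xs : Vec ℕ n) → Between lo hi (hi ∷ xs) ⇔ Between lo hi xs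
between-top m+k≡n⇒m≤n xs = mk⇔
  (λ { (_ ∷ ge , _ ∷ le , _ , os) → ge , le , os })
  (λ { (ge , le , os) → m+k≡n⇒m≤n ∷ ge , ≤-refl ∷ le , inj₂ le , os })

between-proper-or-constant : ∀ {lo hi} → lo ≤ hi → (xs : Vec ℕ n) →
                             (Proper lo hi xs ⊎ xs ≡ replicate n hi) ⇔ Between lo hi xs
between-proper-or-constant {hi = hi} m+k≡n⇒m≤n xs = mk⇔ [ proj₁ , (λ { refl → constant _ }) ]′ split
  where
  constant : ∀ n → Between _ hi (replicate n hi)
  constant zero    = [] , [] , tt
  constant (suc n) = from (between-top m+k≡n⇒m≤n (replicate n hi)) (constant n)
  all-equal : ∀ {n} {ys : Vec ℕ n} → All (_≤ hi) ys → All (hi ≤_) ys → ys ≡ replicate n hi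
  all-equal []       []       = refl
  all-equal (p ∷ ps) (q ∷ qs) = cong₂ _∷_ (≤-antisym p q) (all-equal ps qs)
  split : Between _ hi xs → Proper _ hi xs ⊎ xs ≡ replicate _ hi
  split bt@(_ , le , _) with All.all? (hi ≤?_) xs
  ... | yes top = inj₂ (all-equal le top)
  ... | no ¬top = inj₁ (bt , ¬top)

m+k≡n⇒m≤n : ∀ {lo k hi} → lo + k ≡ hi → lo ≤ hi
m+k≡n⇒m≤n {lo} {k} refl = m≤m+n lo k

counted-between : ∀ q {k lo hi} → lo + k ≡ hi → Counted (Between {q} lo hi) (suc (#proper q k))
counted-proper  : ∀ q {k lo hi} → lo + k ≡ hi → Counted (Proper {q} lo hi) (#proper q k)
counted-below   : ∀ q {k lo hi} → lo + k ≡ hi →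
                  Counted (λ (v : Vec ℕ (suc q)) → Between lo hi v × head v < hi) (#below q k)

counted-between q {k} {lo} {hi} eq =
  subst (Counted _) (+-comm (#proper q k) 1)
    (counted-cong (between-proper-or-constant (m+k≡n⇒m≤n eq))
      (counted-⊎ proper-not-constant (counted-proper q eq) (counted-singleton (replicate q hi))))
  where
  all-top : ∀ n → All (hi ≤_) (replicate n hi)
  all-top zero    = []
  all-top (suc n) = ≤-refl ∷ all-top n
  proper-not-constant : ∀ xs → Proper lo hi xs → xs ≢ replicate q hi
  proper-not-constant xs (_ , ¬top) refl = ¬top (all-top q)

counted-proper zero    eq = counted-∅ (λ { [] (_ , ¬top) → ¬top [] })
counted-proper (suc q) {k} {lo} {hi} eq = counted-cong (λ v → mk⇔ merge split)
  (counted-⊎ (λ { v (_ , <hi) (_ , ≡hi) → <⇒≢ <hi ≡hi })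
    (counted-below q eq)
    (counted-head (Proper lo hi) hi
      (counted-cong proper-top (counted-proper q eq))))
  where
  proper-top : ∀ xs → Proper lo hi xs ⇔ Proper lo hi (hi ∷ xs)
  proper-top xs = mk⇔
    (λ { (bt , ¬top) → from (between-top (m+k≡n⇒m≤n eq) xs) bt , ¬top ∘ All.tail })
    (λ { (bt , ¬top) → to (between-top (m+k≡n⇒m≤n eq) xs) bt , ¬top ∘ (≤-refl ∷_) })
  merge : ∀ {v} → (Between lo hi v × head v < hi) ⊎ (Proper lo hi v × head v ≡ hi) → Proper lo hi v
  merge {_ ∷ _} (inj₁ (bt , <hi)) = bt , <⇒≱ <hi ∘ All.head
  merge         (inj₂ (pr , _))   = pr
  split : ∀ {v} → Proper lo hi v → (Between lo hi v × head v < hi) ⊎ (Proper lo hi v × head v ≡ hi)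
  split {_ ∷ _} pr@(bt@(_ , x≤hi ∷ _ , _) , _) with m≤n⇒m<n∨m≡n x≤hi
  ... | inj₁ <hi = inj₁ (bt , <hi)
  ... | inj₂ ≡hi = inj₂ (pr , ≡hi)

counted-below q {k} {lo} {hi} refl = subst (Counted _) (∑-#proper q k)
  (counted-cong (λ v → mk⇔ merge split)
    (counted-heads (Between lo hi) (λ j → lo + j) _ k (λ _ _ → +-cancelˡ-≡ lo _ _) by-head))
  where
  by-head : ∀ j → j < k → Counted (λ xs → Between lo hi (lo + j ∷ xs)) (suc (#proper q (k ∸ j)) + #proper q j)
  by-head j j<k = counted-cong
    (λ xs → mk⇔ (from (equiv xs)) (to (equiv xs)))
    (counted-⊎ (λ { xs (up , _) (_ , ¬up) → ¬up up })
      (counted-between q (trans (+-assoc lo j (k ∸ j)) (cong (λ z → lo + z) (m+[n∸m]≡n (<⇒≤ j<k)))))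
      (counted-proper q refl))
    where
    equiv : ∀ xs → Between lo hi (lo + j ∷ xs) ⇔ (Between (lo + j) hi xs ⊎ Proper lo (lo + j) xs)
    equiv xs = between-∷ xs (m≤m+n lo j) (+-monoʳ-≤ lo (<⇒≤ j<k))
  merge : ∀ {v} → Between lo hi v × (∃[ j ] j < k × head v ≡ lo + j) → Between lo hi v × head v < hi
  merge (bt , j , j<k , eq) = bt , subst (_< hi) (sym eq) (+-monoʳ-< lo j<k)
  split : ∀ {v} → Between lo hi v × head v < hi → Between lo hi v × (∃[ j ] j < k × head v ≡ lo + j)
  split {x ∷ _} (bt@(lo≤x ∷ _ , _) , x<hi) = bt , x ∸ lo ,
    +-cancelˡ-< lo _ _ (subst (_< hi) (sym (m+[n∸m]≡n lo≤x)) x<hi) , sym (m+[n∸m]≡n lo≤x)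

-- First descent, maximum and falling words

fdes-descent : ∀ {x y} (ys : Vec ℕ n) → y < x → fdes (x ∷ y ∷ ys) ≡ 1
fdes-descent {x = x} {y} ys y<x rewrite dec-true (y <? x) y<x = refl

fdes-ascent : ∀ {x y} (ys : Vec ℕ n) → x ≤ y → fdes (x ∷ y ∷ ys) ≡ suc (fdes (y ∷ ys))
fdes-ascent {x = x} {y} ys x≤y rewrite dec-false (y <? x) (≤⇒≯ x≤y) = refl

max-ascent : ∀ {x y} (ys : Vec ℕ n) → x ≤ y → max (x ∷ y ∷ ys) ≡ max (y ∷ ys)
max-ascent {y = y} ys x≤y = m≤n⇒m⊔n≡n (≤-trans x≤y (m≤m⊔n y (max ys)))

max-head : ∀ {x} (ys : Vec ℕ n) → All (_≤ x) ys → max (x ∷ ys) ≡ x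
max-head {x = x} ys all = m≥n⇒m⊔n≡m (bounded ys all)
  where
  bounded : ∀ {n} (ys : Vec ℕ n) → All (_≤ x) ys → max ys ≤ x
  bounded []       []       = z≤n
  bounded (y ∷ ys) (p ∷ ps) = ⊔-lub p (bounded ys ps)

-- The letters follow a maximum `hi` of slack s. Each repetition of `hi` raises the slack by one, so
-- the equation says that the slack at the first descent is t.
Falling : ℕ → ℕ → ℕ → ℕ → Vec ℕ n → Set
Falling lo hi s t xs = Proper lo hi xs × s + fdes (hi ∷ xs) ≡ suc t

counted-falling : ∀ r {k lo hi} s t → lo + k ≡ hi → Counted (Falling {r} lo hi s t) (#falling k r s t)
counted-falling zero    s t eq = counted-∅ (λ { [] ((_ , ¬top) , _) → ¬top [] })
counted-falling (suc r) {k} {lo} {hi} s t eq = counted-cong (λ v → mk⇔ merge split)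
  (counted-⊎ (λ { v ((_ , <hi) , _) (_ , ≡hi) → <⇒≢ <hi ≡hi })
    (counted-when s t (counted-below r eq))
    (counted-head (Falling lo hi s t) hi
      (counted-cong falling-top (counted-falling r (suc s) t eq))))
  where
  fdes-top : ∀ xs → suc s + fdes (hi ∷ xs) ≡ s + fdes (hi ∷ hi ∷ xs)
  fdes-top xs = trans (sym (+-suc s _)) (cong (λ z → s + z) (sym (fdes-ascent xs ≤-refl)))
  falling-top : ∀ xs → Falling lo hi (suc s) t xs ⇔ Falling lo hi s t (hi ∷ xs)
  falling-top xs = mk⇔
    (λ { ((bt , ¬top) , eq′) →
      (from (between-top (m+k≡n⇒m≤n eq) xs) bt , ¬top ∘ All.tail) , trans (sym (fdes-top xs)) eq′ })
    (λ { ((bt , ¬top) , eq′) →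
      (to (between-top (m+k≡n⇒m≤n eq) xs) bt , ¬top ∘ (≤-refl ∷_)) , trans (fdes-top xs) eq′ })
  merge : ∀ {v} → ((Between lo hi v × head v < hi) × s ≡ t) ⊎ (Falling lo hi s t v × head v ≡ hi) →
          Falling lo hi s t v
  merge {x ∷ xs} (inj₁ ((bt , <hi) , refl)) = (bt , <⇒≱ <hi ∘ All.head) ,
    trans (cong (λ z → s + z) (fdes-descent xs <hi)) (+-comm s 1)
  merge (inj₂ (fl , _)) = fl
  split : ∀ {v} → Falling lo hi s t v →
          ((Between lo hi v × head v < hi) × s ≡ t) ⊎ (Falling lo hi s t v × head v ≡ hi)
  split {x ∷ xs} fl@((bt@(_ , x≤hi ∷ _ , _) , _) , eq′) with m≤n⇒m<n∨m≡n x≤hi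
  ... | inj₁ <hi = inj₁ ((bt , <hi) ,
    suc-injective (trans (+-comm 1 s) (trans (cong (λ z → s + z) (sym (fdes-descent xs <hi))) eq′)))
  ... | inj₂ ≡hi = inj₂ (fl , ≡hi)

-- The inversion bound and rising words

InvFrom : ℕ → Vec ℕ n → Set
InvFrom i []       = ⊤
InvFrom i (x ∷ xs) = x ≤ i × InvFrom (suc i) xs

-- Positions grow while the letters stay at or below x; this recovers the inversion bound after the
-- maximum.
bounded⇒invFrom : ∀ {x i} {xs : Vec ℕ n} → x ≤ i → All (_≤ x) xs → InvFrom i xs
bounded⇒invFrom x≤i []       = tt
bounded⇒invFrom x≤i (p ∷ ps) = ≤-trans p x≤i , bounded⇒invFrom (m≤n⇒m≤1+n x≤i) ps

lookup⇔invFrom : ∀ i (xs : Vec ℕ n) → (∀ j → lookup xs j ≤ i + toℕ j) ⇔ InvFrom i xs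
lookup⇔invFrom i []       = mk⇔ (λ _ → tt) (λ _ ())
lookup⇔invFrom i (x ∷ xs) = mk⇔
  (λ bound → subst (x ≤_) (+-identityʳ i) (bound zero) ,
             to (lookup⇔invFrom (suc i) xs) (λ j → subst (lookup xs j ≤_) (+-suc i (toℕ j)) (bound (suc j))))
  (λ { (x≤i , inv) zero    → subst (x ≤_) (sym (+-identityʳ i)) x≤i
     ; (x≤i , inv) (suc j) → subst (lookup xs j ≤_) (sym (+-suc i (toℕ j))) (from (lookup⇔invFrom (suc i) xs) inv j) })

-- Here v is the letter just read, at 0-based position v + s. Hence v + s + `fdes (v ∷ xs)` is the
-- 1-based first descent of the whole sequence, and the equation says that the rank is t.
Rising : ℕ → ℕ → ℕ → Vec ℕ n → Set
Rising v s t xs =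
  All (v ≤_) xs × InvFrom (suc (v + s)) xs × OneSided xs × v + s + fdes (v ∷ xs) ≡ suc (t + max (v ∷ xs))

rising-[] : ∀ v s t → Rising v s t [] ⇔ s ≡ t
rising-[] v s t = mk⇔
  (λ { (_ , _ , _ , eq) → +-cancelˡ-≡ v s t (suc-injective
    (trans (+-comm 1 (v + s)) (trans eq (cong suc (trans (cong (λ z → t + z) (⊔-identityʳ v)) (+-comm t v)))))) })
  (λ { refl → [] , tt , tt ,
    trans (+-comm (v + s) 1) (cong suc (trans (+-comm v s) (cong (λ z → s + z) (sym (⊔-identityʳ v))))) })

-- The next letter x has slack i. If all later letters are ≥ x, the rise continues from x; otherwise
-- x is the maximum, and cancelling it turns the rank equation into that of `Falling`.
rising-∷ : ∀ {v s t x i} (xs : Vec ℕ n) → v ≤ x → x + i ≡ suc (v + s) →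
           Rising v s t (x ∷ xs) ⇔ (Rising x i t xs ⊎ Falling v x i t xs)
rising-∷ {v = v} {s} {t} {x} {i} xs v≤x x+i≡ = mk⇔ split merge
  where
  x≤ : x ≤ suc (v + s)
  x≤ = m+k≡n⇒m≤n x+i≡
  position : v + s + fdes (v ∷ x ∷ xs) ≡ x + i + fdes (x ∷ xs)
  position = trans (cong (λ z → v + s + z) (fdes-ascent xs v≤x))
    (trans (+-suc (v + s) _) (cong (_+ fdes (x ∷ xs)) (sym x+i≡)))
  target : suc (t + max (v ∷ x ∷ xs)) ≡ suc (t + max (x ∷ xs))
  target = cong (λ z → suc (t + z)) (max-ascent xs v≤x)
  target-falling : All (_≤ x) xs → suc (t + max (x ∷ xs)) ≡ x + suc t
  target-falling down = trans (cong (λ z → suc (t + z)) (max-head xs down)) (+-comm (suc t) x)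
  split : Rising v s t (x ∷ xs) → Rising x i t xs ⊎ Falling v x i t xs
  split (_ ∷ ge , (_ , inv) , (side , os) , eq) with All.all? (x ≤?_) xs | side
  ... | yes up | _         = inj₁ (up , subst (λ z → InvFrom (suc z) xs) (sym x+i≡) inv , os ,
                                   trans (sym position) (trans eq target))
  ... | no ¬up | inj₁ up   = contradiction up ¬up
  ... | no ¬up | inj₂ down = inj₂ (((ge , down , os) , ¬up) , +-cancelˡ-≡ x _ _
    (trans (sym (+-assoc x i _)) (trans (sym position) (trans eq (trans target (target-falling down))))))
  merge : Rising x i t xs ⊎ Falling v x i t xs → Rising v s t (x ∷ xs)
  merge (inj₁ (up , inv , os , eq)) =
    v≤x ∷ All.map (≤-trans v≤x) up , (x≤ , subst (λ z → InvFrom (suc z) xs) x+i≡ inv) , (inj₁ up , os) ,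
    trans position (trans eq (sym target))
  merge (inj₂ (((ge , down , os) , ¬up) , eq)) =
    v≤x ∷ ge , (x≤ , bounded⇒invFrom (m≤n⇒m≤1+n x≤) down) , (inj₂ down , os) ,
    trans position (trans (+-assoc x i _) (trans (cong (λ z → x + z) eq)
      (trans (sym (target-falling down)) (sym target))))

counted-rising : ∀ r v s t → Counted (Rising {r} v s t) (#rising t r s)
counted-rising zero    v s t = subst (Counted _) (*-identityʳ (δ s t))
  (counted-cong (λ { [] → mk⇔ (from (rising-[] v s t) ∘ proj₂) (λ ri → refl , to (rising-[] v s t) ri) })
    (counted-when s t (counted-singleton [])))
counted-rising (suc r) v s t = counted-cong (λ w → mk⇔ proj₁ (λ ri → ri , head-index ri))
  -- The next letter is indexed by its slack i, from 0 at the largest admissible value v + s + 1 up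
  -- to s + 1 at v.
  (counted-heads (Rising v s t) (top ∸_) _ (2 + s)
    (λ { (s≤s i≤) (s≤s j≤) → ∸-cancelˡ-≡ (≤top i≤) (≤top j≤) }) by-head)
  where
  top : ℕ
  top = v + suc s
  ≤top : ∀ {i} → i ≤ suc s → i ≤ top
  ≤top i≤ = ≤-trans i≤ (m≤n+m (suc s) v)
  by-head : ∀ i → i < 2 + s → Counted (λ xs → Rising v s t (top ∸ i ∷ xs)) (#rising t r i + #falling (suc s ∸ i) r i t)
  by-head i (s≤s i≤) = counted-cong (λ xs → mk⇔ (from (equiv xs)) (to (equiv xs)))
    (counted-⊎ (λ { xs (up , _) ((_ , ¬up) , _) → ¬up up })
      (counted-rising r (top ∸ i) i t)
      (counted-falling r i t gap))
    where
    gap : v + (suc s ∸ i) ≡ top ∸ i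
    gap = sym (+-∸-assoc v i≤)
    equiv : ∀ xs → Rising v s t (top ∸ i ∷ xs) ⇔ (Rising (top ∸ i) i t xs ⊎ Falling v (top ∸ i) i t xs)
    equiv xs = rising-∷ xs (m+k≡n⇒m≤n gap) (trans (m∸n+n≡m (≤top i≤)) (+-suc v s))
  head-index : ∀ {w} → Rising v s t w → ∃[ i ] i < 2 + s × head w ≡ top ∸ i
  head-index {x ∷ _} (v≤x ∷ _ , (x≤ , _) , _) = top ∸ x ,
    s≤s (≤-trans (∸-monoʳ-≤ top v≤x) (≤-reflexive (m+n∸m≡n v (suc s)))) ,
    sym (m∸[m∸n]≡n (subst (x ≤_) (sym (+-suc v s)) x≤))

-- Assembling the count by rank

rank⇔ : ∀ f m t → (+ f ℤ.- + m ℤ.- + 1 ≡ + t) ⇔ f ≡ suc (t + m)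
rank⇔ f m t = mk⇔
  (λ eq → ℤ.+-injective (trans (undo (+ f) (+ m)) (cong (λ z → + 1 ℤ.+ (z ℤ.+ + m)) eq)))
  (λ { refl → redo (+ t) (+ m) })
  where
  undo : ∀ f m → f ≡ + 1 ℤ.+ (f ℤ.- m ℤ.- + 1 ℤ.+ m)
  undo = ℤ-solve-∀
  redo : ∀ t m → + 1 ℤ.+ (t ℤ.+ m) ℤ.- m ℤ.- + 1 ≡ t
  redo = ℤ-solve-∀

Rank102-120 : ℕ → Vec ℕ n → Set
Rank102-120 t e = IsInversionSequence e × Avoids e pattern102 × Avoids e pattern120 × rank e ≡ + t

-- The first entry is forced to be 0, so the rest is a rising continuation of a letter 0 with slack
-- 0.
counted-rank : ∀ r t → Counted (Rank102-120 {suc r} t) (#rising t r 0)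
counted-rank r t = counted-cong (λ v → mk⇔ proj₁ (λ p → p , head≡0 {v} p))
  (counted-head (Rank102-120 t) 0 (counted-cong start (counted-rising r 0 0 t)))
  where
  start : ∀ xs → Rising 0 0 t xs ⇔ Rank102-120 t (0 ∷ xs)
  start xs = mk⇔
    (λ { (ge , inv , os , eq) → let os′ = inj₁ ge , os in
      from (lookup⇔invFrom 0 (0 ∷ xs)) (z≤n , inv) ,
      oneSided⇒avoids102 (0 ∷ xs) os′ , oneSided⇒avoids120 (0 ∷ xs) os′ ,
      from (rank⇔ (fdes (0 ∷ xs)) (max xs) t) eq })
    (λ { (inv , a₁ , a₂ , eq) →
      Allₚ.lookup⁻ (λ _ → z≤n) , proj₂ (to (lookup⇔invFrom 0 (0 ∷ xs)) inv) ,
      proj₂ (avoids⇒oneSided (0 ∷ xs) a₁ a₂) , to (rank⇔ (fdes (0 ∷ xs)) (max xs) t) eq })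
  head≡0 : ∀ {v} → Rank102-120 {suc r} t v → head v ≡ 0
  head≡0 {x ∷ _} (inv , _) = n≤0⇒n≡0 (inv zero)

proposition5p9 : ∀ (n t : ℕ) → 2 ≤ n → t ≤ n ∸ 2 →
    NumberOf (λ (e : Vec ℕ n) → IsInversionSequence e × Avoids e pattern102 × Avoids e pattern120 × rank e ≡ + t)
    Is (+ ((2 * n ∸ t ∸ 2) C (n ∸ t ∸ 1)) ℤ.- + ((2 * n ∸ 2 * t ∸ 3) C (n ∸ t ∸ 1)))
proposition5p9 (suc (suc m)) t (s≤s (s≤s z≤n)) t≤m =
  subst (λ z → NumberOf (Rank102-120 {suc (suc m)} t) Is z) value (counted-rank (suc m) t)
  where
  -- With a = n - t - 2 all truncated subtractions in the formula become exact.
  a : ℕ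
  a = m ∸ t
  m≡a+t : m ≡ a + t
  m≡a+t = sym (m∸n+n≡m t≤m)
  exact : ∀ {x y z} → x ≡ y + z → x ∸ z ≡ y
  exact {y = y} {z} refl = m+n∸n≡m y z
  upper : 2 * (2 + m) ∸ t ∸ 2 ≡ 2 + 2 * a + t
  upper = exact (exact (trans (cong (λ z → 2 * (2 + z)) m≡a+t) (size a t)))
    where
    size : ∀ a t → 2 * (2 + (a + t)) ≡ 2 + 2 * a + t + 2 + t
    size = solve-∀
  lowerTop : 2 * (2 + m) ∸ 2 * t ∸ 3 ≡ suc (2 * a)
  lowerTop = exact (exact (trans (cong (λ z → 2 * (2 + z)) m≡a+t) (size a t)))
    where
    size : ∀ a t → 2 * (2 + (a + t)) ≡ suc (2 * a) + 3 + 2 * t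
    size = solve-∀
  lower : 2 + m ∸ t ∸ 1 ≡ suc a
  lower = exact (exact (trans (cong (λ z → 2 + z) m≡a+t) (size a t)))
    where
    size : ∀ a t → 2 + (a + t) ≡ suc a + 1 + t
    size = solve-∀
  +-cancel : ∀ x y → x ≡ x ℤ.+ y ℤ.- y
  +-cancel = ℤ-solve-∀
  value : + #rising t (suc m) 0 ≡ + ((2 * (2 + m) ∸ t ∸ 2) C (2 + m ∸ t ∸ 1)) ℤ.- + ((2 * (2 + m) ∸ 2 * t ∸ 3) C (2 + m ∸ t ∸ 1))
  value = begin
    + #rising t (suc m) 0
      -- Adding and subtracting `c` carries the additive identity in ℕ over to a difference in ℤ.
      ≡⟨ +-cancel (+ #rising t (suc m) 0) (+ c) ⟩
    + (#rising t (suc m) 0 + c) ℤ.- + c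
      ≡⟨ cong (λ z → + (#rising t (suc z) 0 + c) ℤ.- + c) m≡a+t ⟩
    + (#rising t (suc (a + t)) 0 + c) ℤ.- + c
      ≡⟨ cong (λ z → + z ℤ.- + c) (#rising-closed t a) ⟩
    + ((2 + 2 * a + t) C suc a) ℤ.- + (suc (2 * a) C suc a)
      ≡⟨ cong₂ (λ y z → + (y C suc a) ℤ.- + (z C suc a)) (sym upper) (sym lowerTop) ⟩
    + ((2 * (2 + m) ∸ t ∸ 2) C suc a) ℤ.- + ((2 * (2 + m) ∸ 2 * t ∸ 3) C suc a)
      ≡⟨ cong (λ k → + ((2 * (2 + m) ∸ t ∸ 2) C k) ℤ.- + ((2 * (2 + m) ∸ 2 * t ∸ 3) C k)) (sym lower) ⟩
    + ((2 * (2 + m) ∸ t ∸ 2) C (2 + m ∸ t ∸ 1)) ℤ.- + ((2 * (2 + m) ∸ 2 * t ∸ 3) C (2 + m ∸ t ∸ 1)) ∎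
    where
    c : ℕ
    c = suc (2 * a) C suc a
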